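{- With the conventions $g(0)=h(0)=g_1(0)=h_1(0)=0$, for all $M\geq 2$: $$g(M)=g(M-1)+g(M-2)+F_{M-1},\qquad h(M)=h(M-1)+h(M-2)+F_{M-2},$$ $$g_1(M)=g_1(M-1)+g_1(M-2)+F_{M-1},\qquad h_1(M)=h_1(M-1)+h_1(M-2)+F_{M-1}.$$
   Context: $F_k$ denotes the Fibonacci numbers with $F_{ -1}=1$, $F_0=0$, $F_1=1$, $F_k=F_{k-1}+F_{k-2}$. The perimeter of a nonempty partition $\lambda$ with largest part $\lambda_1$ and $\ell(\lambda)$ parts is $\lambda_1+\ell(\lambda)-1$. $\mathcal G(M)$ is the set of partitions into odd parts with perimeter $M$, $\mathcal H(M)$ the set of partitions into distinct parts with perimeter $M$; $g(M)$ (resp. $h(M)$) is the total number of parts, summed over all partitions in $\mathcal G(M)$ (resp. $\mathcal H(M)$). $\mathcal G_1(M)$ is the set of partitions with perimeter $M$ in which exactly one distinct even integer occurs as a part (possibly with multiplicity greater than one) and all other parts are odd; $\mathcal H_1(M)$ is the set of partitions with perimeter $M$ in which exactly one part value occurs at least twice and every other part value occurs exactly once. $g_1(M)=|\mathcal G_1(M)|$, $h_1(M)=|\mathcal H_1(M)|$. -}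

module Defs where

open import Data.Empty using (⊥)
open import Data.List.Base using (List; []; _∷_; length; map; filter; upTo; cartesianProductWith)
open import Data.List.Membership.Propositional using (_∈_; find; lose)
open import Data.List.Membership.Propositional.Properties using (∈-filter⁺; ∈-filter⁻; ∈-cartesianProductWith⁺; ∈-cartesianProductWith⁻; ∈-upTo⁺)
open import Data.List.Properties using (∷-injective)
open import Data.List.Relation.Unary.All as All using (All; []; _∷_; all?)
open import Data.List.Relation.Unary.AllPairs using ([]; _∷_)
open import Data.List.Relation.Unary.Any using (here; there; any?)
open import Data.List.Relation.Unary.Linked using (Linked; linked?)
open import Data.List.Relation.Unary.Linked.Properties using (Linked⇒All)
open import Data.List.Relation.Unary.Unique.Propositional using (Unique)
open import Data.List.Relation.Unary.Unique.Propositional.Properties using (filter⁺; cartesianProductWith⁺; upTo⁺)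
open import Data.Nat using (ℕ; zero; suc; _+_; _∸_; _≤_; _<_; _≥_; s≤s; _≟_; _≤?_; _≥?_; _<?_)
open import Data.List.Relation.Unary.Unique.DecPropositional _≟_ using (unique?)
open import Data.Nat.Divisibility using (_∣_; _∤_; _∣?_)
open import Data.Nat.ListAction using (sum)
open import Data.Nat.Properties using (≤-trans; ≤-reflexive; m≤m+n; m≤n+m; +-suc)
open import Data.Product using (_×_; _,_; ∃; proj₁; proj₂)
open import Function.Base using (_∘_)
open import Function.Bundles using (_⇔_; mk⇔)
open import Relation.Binary.PropositionalEquality using (_≡_; _≢_; refl; sym; trans; cong)
open import Relation.Nullary using (Dec; yes; no; ¬?)
open import Relation.Nullary.Decidable using (_×-dec_; _→-dec_; map′)
open import Relation.Unary using (Decidable)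

-- The value F₋₁ = 1 never occurs below: for M ≥ 2 the indices M - 1, M - 2 are ≥ 0.
F : ℕ → ℕ
F zero          = 0
F (suc zero)    = 1
F (suc (suc k)) = F (suc k) + F k

-- The parts are listed in weakly decreasing order, so the head is the largest part.
IsPartition : List ℕ → Set
IsPartition xs = Linked _≥_ xs × All (0 <_) xs

-- The perimeter is undefined for the empty partition, which therefore has no
-- perimeter M for any M; on nonempty lists the subtraction does not truncate.
HasPerimeter : ℕ → List ℕ → Set
HasPerimeter M []          = ⊥
HasPerimeter M xs@(x ∷ _) = x + length xs ∸ 1 ≡ M

PartitionOfPerimeter : ℕ → List ℕ → Set
PartitionOfPerimeter M xs = IsPartition xs × HasPerimeter M xs

multiplicity : ℕ → List ℕ → ℕ
multiplicity v xs = length (filter (v ≟_) xs)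

Even Odd : ℕ → Set
Even p = 2 ∣ p
Odd  p = 2 ∤ p

OddParts : List ℕ → Set
OddParts = All Odd

DistinctParts : List ℕ → Set
DistinctParts = Unique

OneEvenPart : List ℕ → Set
OneEvenPart xs = ∃ λ e → e ∈ xs × Even e × All (λ p → p ≢ e → Odd p) xs

OneRepeatedPart : List ℕ → Set
OneRepeatedPart xs =
  ∃ λ v → v ∈ xs × 2 ≤ multiplicity v xs × All (λ u → u ≢ v → multiplicity u xs ≡ 1) xs

𝒢 ℋ 𝒢₁ ℋ₁ : ℕ → List ℕ → Set
𝒢  M xs = PartitionOfPerimeter M xs × OddParts xs
ℋ  M xs = PartitionOfPerimeter M xs × DistinctParts xs
𝒢₁ M xs = PartitionOfPerimeter M xs × OneEvenPart xs
ℋ₁ M xs = PartitionOfPerimeter M xs × OneRepeatedPart xs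

-- A finite set of lists. Any two enumerations of P are permutations of each
-- other, so cardinalities and sums over P do not depend on the choice made below.
record Enumeration (P : List ℕ → Set) : Set where
  field
    elements : List (List ℕ)
    unique   : Unique elements
    exact    : ∀ xs → xs ∈ elements ⇔ P xs

open Enumeration public

cardinality : ∀ {P} → Enumeration P → ℕ
cardinality E = length (elements E)

totalParts : ∀ {P} → Enumeration P → ℕ
totalParts E = sum (map length (elements E))

isPartition? : Decidable IsPartition
isPartition? xs = linked? _≥?_ xs ×-dec all? (0 <?_) xs

hasPerimeter? : ∀ M → Decidable (HasPerimeter M)
hasPerimeter? M []          = no λ ()
hasPerimeter? M xs@(x ∷ _) = x + length xs ∸ 1 ≟ M

oddParts? : Decidable OddParts
oddParts? = all? (λ p → ¬? (2 ∣? p))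

any∈? : ∀ {P : ℕ → Set} → Decidable P → ∀ xs → Dec (∃ λ x → x ∈ xs × P x)
any∈? P? xs = map′ find (λ (_ , x∈xs , px) → lose x∈xs px) (any? P? xs)

oneEvenPart? : Decidable OneEvenPart
oneEvenPart? xs =
  any∈? (λ e → (2 ∣? e) ×-dec all? (λ p → ¬? (p ≟ e) →-dec ¬? (2 ∣? p)) xs) xs

oneRepeatedPart? : Decidable OneRepeatedPart
oneRepeatedPart? xs =
  any∈? (λ v → (2 ≤? multiplicity v xs)
         ×-dec all? (λ u → ¬? (u ≟ v) →-dec (multiplicity u xs ≟ 1)) xs) xs

-- All lists of length at most k with entries below n.
boundedLists : ℕ → ℕ → List (List ℕ)
boundedLists n zero    = [] ∷ []
boundedLists n (suc k) = [] ∷ cartesianProductWith _∷_ (upTo n) (boundedLists n k)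

boundedLists-unique : ∀ n k → Unique (boundedLists n k)
boundedLists-unique n zero    = [] ∷ []
boundedLists-unique n (suc k) =
  All.tabulate nonempty ∷
  cartesianProductWith⁺ _∷_ ∷-injective (upTo⁺ n) (boundedLists-unique n k)
  where
  nonempty : ∀ {ys} → ys ∈ cartesianProductWith _∷_ (upTo n) (boundedLists n k) → [] ≢ ys
  nonempty ys∈ refl with ∈-cartesianProductWith⁻ _∷_ (upTo n) (boundedLists n k) ys∈
  ... | _ , _ , _ , _ , ()

boundedLists-complete : ∀ {n k} xs → All (_< n) xs → length xs ≤ k → xs ∈ boundedLists n k
boundedLists-complete {k = zero}  []       _          _         = here refl
boundedLists-complete {k = suc k} []       _          _         = here refl
boundedLists-complete {k = suc k} (x ∷ xs) (x<n ∷ ps) (s≤s len) =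
  there (∈-cartesianProductWith⁺ _∷_ (∈-upTo⁺ x<n) (boundedLists-complete xs ps len))

perimeter-bounds : ∀ {M} xs → PartitionOfPerimeter M xs → All (_< suc M) xs × length xs ≤ M
perimeter-bounds {M} (x ∷ xs) ((dec , pos ∷ _) , per) =
  All.map (λ y≤x → s≤s (≤-trans y≤x x≤M)) (Linked⇒All (λ p q → ≤-trans q p) (≤-reflexive refl) dec) ,
  length≤M pos per
  where
  x≤M : x ≤ M
  x≤M = ≤-trans (m≤m+n x (length xs)) (≤-reflexive (trans (cong (_∸ 1) (sym (+-suc x (length xs)))) per))

  length≤M : ∀ {x} → 0 < x → x + suc (length xs) ∸ 1 ≡ M → suc (length xs) ≤ M
  length≤M {suc x} _ eq = ≤-trans (m≤n+m (suc (length xs)) x) (≤-reflexive eq)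

enumerate : ∀ {Q : List ℕ → Set} → Decidable Q → ∀ M →
            Enumeration (λ xs → PartitionOfPerimeter M xs × Q xs)
enumerate {Q} Q? M = record
  { elements = filter P? (boundedLists (suc M) M)
  ; unique   = filter⁺ P? (boundedLists-unique (suc M) M)
  ; exact    = λ xs → mk⇔ (proj₂ ∘ ∈-filter⁻ P? {xs = boundedLists (suc M) M})
                          (λ p → let bounds = perimeter-bounds xs (proj₁ p) in
                                 ∈-filter⁺ P? (boundedLists-complete xs (proj₁ bounds) (proj₂ bounds)) p)
  }
  where
  P? : Decidable (λ xs → PartitionOfPerimeter M xs × Q xs)
  P? xs = (isPartition? xs ×-dec hasPerimeter? M xs) ×-dec Q? xs

𝒢-enum : ∀ M → Enumeration (𝒢 M)
𝒢-enum = enumerate oddParts?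

ℋ-enum : ∀ M → Enumeration (ℋ M)
ℋ-enum = enumerate unique?

𝒢₁-enum : ∀ M → Enumeration (𝒢₁ M)
𝒢₁-enum = enumerate oneEvenPart?

ℋ₁-enum : ∀ M → Enumeration (ℋ₁ M)
ℋ₁-enum = enumerate oneRepeatedPart?

g h g₁ h₁ : ℕ → ℕ
g  M = totalParts  (𝒢-enum M)
h  M = totalParts  (ℋ-enum M)
g₁ M = cardinality (𝒢₁-enum M)
h₁ M = cardinality (ℋ₁-enum M)

-- The conventions at 0 hold automatically, as no nonempty partition has perimeter 0.
conventions : g 0 ≡ 0 × h 0 ≡ 0 × g₁ 0 ≡ 0 × h₁ 0 ≡ 0
conventions = refl , refl , refl , refl

{-# OPTIONS --safe #-}
module Submission where

-- Every partition of perimeter M + 1 ≥ 2 arises from a unique partition of perimeter M,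
-- either by increasing the largest part (inc) or by repeating it (dup).  Following the
-- parity, respectively the repetition, of the largest part gives disjoint decompositions
--   𝒢  (M+2) = dup (𝒢 (M+1)) ∪ inc² (𝒢 M),
--   ℋ  (M+2) = inc (ℋ (M+1)) ∪ inc dup (ℋ M),
--   𝒢₁ (M+2) = inc (𝒢 (M+1)) ∪ dup (𝒢₁ (M+1)) ∪ φ (𝒢₁ M),
--   ℋ₁ (M+2) = dup (ℋ (M+1)) ∪ ψ (ℋ₁ (M+1)) ∪ inc dup (ℋ₁ M),
-- where φ is inc dup on partitions with even largest part and inc² on the others, and ψ
-- is dup on partitions with repeated largest part and inc on the others.  The first two
-- give |𝒢 M| = |ℋ M| = F M, and inc preserves the number of parts while dup adds one.

open import Defs
open import Data.Bool.Base using (if_then_else_)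
open import Data.Empty using (⊥)
open import Data.List.Base using (List; []; _∷_; _++_; length; map)
open import Data.List.Membership.Propositional using (_∈_; _∉_)
open import Data.List.Membership.Propositional.Properties using (∈-map⁺; ∈-map⁻; ∈-++⁺ˡ; ∈-++⁺ʳ; ∈-++⁻)
open import Data.List.Membership.Propositional.Properties.WithK using (unique∧set⇒bag)
open import Data.List.Properties using (∷-injectiveʳ; length-map; length-++; map-++; filter-accept; filter-reject; filter-none; filter-some)
open import Data.List.Relation.Binary.BagAndSetEquality using (∼bag⇒↭)
open import Data.List.Relation.Binary.Permutation.Propositional using (_↭_)
import Data.List.Relation.Binary.Permutation.Propositional.Properties as ↭
open import Data.List.Relation.Unary.All as All using (All; []; _∷_)
open import Data.List.Relation.Unary.All.Properties as All using (¬Any⇒All¬; All¬⇒¬Any)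
open import Data.List.Relation.Unary.AllPairs using ([]; _∷_)
open import Data.List.Relation.Unary.Any using (here; there)
open import Data.List.Relation.Unary.Linked as Linked using (Linked; [-]; _∷_)
open import Data.List.Relation.Unary.Linked.Properties using (Linked⇒All)
open import Data.List.Relation.Unary.Unique.Propositional using (Unique)
open import Data.List.Relation.Unary.Unique.Propositional.Properties as Unique using ()
open import Data.Nat using (ℕ; zero; suc; _+_; _*_; _∸_; _≤_; _<_; _≥_; s≤s; z<s; _≟_)
open import Data.List.Membership.DecPropositional _≟_ using (_∈?_)
open import Data.Nat.Divisibility using (_∣?_; ∣-refl; ∣m∣n⇒∣m+n; ∣m+n∣m⇒∣n; ∣1⇒≡1; _∣0)
open import Data.Nat.ListAction using (sum)
open import Data.Nat.ListAction.Properties using (sum-++; sum-↭)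
open import Data.Nat.Properties using (≤-trans; ≤-refl; m≤n⇒m≤1+n; n≤1+n; <-irrefl; <⇒≢; m≤n⇒m<n∨m≡n; +-suc; suc-injective; +-comm; *-zeroʳ)
open import Data.Nat.Tactic.RingSolver using (solve-∀)
open import Data.Product using (_×_; _,_; ∃)
open import Data.Sum.Base as Sum using (inj₁; inj₂; [_,_]′)
open import Function.Base using (_∘_; const)
open import Function.Bundles using (_⇔_; mk⇔; Equivalence)
open import Relation.Binary.PropositionalEquality using (_≡_; _≢_; refl; sym; trans; cong; cong₂; subst; ≢-sym; module ≡-Reasoning)
open import Relation.Nullary using (yes; no; does; contradiction)
open import Relation.Nullary.Decidable using (dec-true; dec-false)
open import Relation.Unary using (_∪_)

open Equivalence using (to; from)

-- Enumerations

Image : (List ℕ → List ℕ) → (List ℕ → Set) → List ℕ → Set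
Image f P ys = ∃ λ xs → P xs × f xs ≡ ys

-- Injectivity is relative to `P` because `φ` and `ψ` are not injective on arbitrary lists: `φ`
-- sends both `1 ∷ 2 ∷ []` and `2 ∷ []` to `3 ∷ 2 ∷ []`.
InjectiveOn : (List ℕ → Set) → (List ℕ → List ℕ) → Set
InjectiveOn P f = ∀ {xs ys} → P xs → P ys → f xs ≡ f ys → xs ≡ ys

module _ {P : List ℕ → Set} {f : List ℕ → List ℕ} where

  unique-map : InjectiveOn P f → ∀ {xss} → All P xss → Unique xss → Unique (map f xss)
  unique-map f-inj []         []           = []
  unique-map f-inj (px ∷ pxs) (x∉xs ∷ xs!) =
    All.map⁺ (All.zipWith (λ (py , x≢y) → x≢y ∘ f-inj px py) (pxs , x∉xs)) ∷ unique-map f-inj pxs xs!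

  image : InjectiveOn P f → Enumeration P → Enumeration (Image f P)
  image f-inj E = record
    { elements = map f (elements E)
    ; unique   = unique-map f-inj (All.tabulate (to (exact E _))) (unique E)
    ; exact    = λ ys → mk⇔
        (λ ys∈ → let xs , xs∈ , eq = ∈-map⁻ f ys∈ in xs , to (exact E xs) xs∈ , sym eq)
        λ { (xs , px , refl) → ∈-map⁺ f (from (exact E xs) px) }
    }

union : ∀ {P Q} → (∀ {xs} → P xs → Q xs → ⊥) → Enumeration P → Enumeration Q → Enumeration (P ∪ Q)
union disjoint E E′ = record
  { elements = elements E ++ elements E′
  ; unique   = Unique.++⁺ (unique E) (unique E′)
                 (λ (xs∈E , xs∈E′) → disjoint (to (exact E _) xs∈E) (to (exact E′ _) xs∈E′))
  ; exact    = λ xs → mk⇔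
      (Sum.map (to (exact E xs)) (to (exact E′ xs)) ∘ ∈-++⁻ (elements E))
      [ ∈-++⁺ˡ ∘ from (exact E xs) , ∈-++⁺ʳ (elements E) ∘ from (exact E′ xs) ]′
  }

-- In a duplicate-free list every member has multiplicity one, so two such lists with the same
-- members agree as bags. This transfers counts between the filtered enumerations and the unions of
-- images.
enumeration-↭ : ∀ {P Q} → (∀ xs → P xs ⇔ Q xs) → (E : Enumeration P) (E′ : Enumeration Q) →
                elements E ↭ elements E′
enumeration-↭ P⇔Q E E′ = ∼bag⇒↭ (unique∧set⇒bag (unique E) (unique E′) λ {xs} → mk⇔
  (from (exact E′ xs) ∘ to (P⇔Q xs) ∘ to (exact E xs))
  (from (exact E xs) ∘ from (P⇔Q xs) ∘ to (exact E′ xs)))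

cardinality-⇔ : ∀ {P Q} → (∀ xs → P xs ⇔ Q xs) → (E : Enumeration P) (E′ : Enumeration Q) →
                cardinality E ≡ cardinality E′
cardinality-⇔ P⇔Q E E′ = ↭.↭-length (enumeration-↭ P⇔Q E E′)

totalParts-⇔ : ∀ {P Q} → (∀ xs → P xs ⇔ Q xs) → (E : Enumeration P) (E′ : Enumeration Q) →
               totalParts E ≡ totalParts E′
totalParts-⇔ P⇔Q E E′ = sum-↭ (↭.map⁺ length (enumeration-↭ P⇔Q E E′))

module _ {P Q} (disjoint : ∀ {xs} → P xs → Q xs → ⊥) (E : Enumeration P) (E′ : Enumeration Q) where

  cardinality-union : cardinality (union disjoint E E′) ≡ cardinality E + cardinality E′
  cardinality-union = length-++ (elements E)

  totalParts-union : totalParts (union disjoint E E′) ≡ totalParts E + totalParts E′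
  totalParts-union = trans (cong sum (map-++ length (elements E) (elements E′)))
                           (sum-++ (map length (elements E)) (map length (elements E′)))

module _ {P f} (f-inj : InjectiveOn P f) (E : Enumeration P) where

  cardinality-image : cardinality (image f-inj E) ≡ cardinality E
  cardinality-image = length-map f (elements E)

  -- Each list gains the same number `k` of parts, so the total gains `k` per enumerated list.
  totalParts-image : ∀ k → (∀ xs → length (f xs) ≡ k + length xs) →
                     totalParts (image f-inj E) ≡ totalParts E + k * cardinality E
  totalParts-image k length-f = go (elements E)
    where
    regroup : ∀ k l s n → (k + l) + (s + k * n) ≡ (l + s) + k * suc n
    regroup = solve-∀

    go : ∀ xss → sum (map length (map f xss)) ≡ sum (map length xss) + k * length xss
    go []         = sym (*-zeroʳ k)
    go (xs ∷ xss) = trans (cong₂ _+_ (length-f xs) (go xss))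
                          (regroup k (length xs) (sum (map length xss)) (length xss))

module _ {P A B f k}
  (decomposition : ∀ xs → P xs ⇔ (Image f A ∪ Image k B) xs)
  (disjoint : ∀ {xs} → Image f A xs → Image k B xs → ⊥)
  (f-inj : InjectiveOn A f) (k-inj : InjectiveOn B k)
  (Eᴾ : Enumeration P) (Eᴬ : Enumeration A) (Eᴮ : Enumeration B)
  where

  private
    Fᴬ = image f-inj Eᴬ
    Fᴮ = image k-inj Eᴮ

  cardinality-∪ : cardinality Eᴾ ≡ cardinality Eᴬ + cardinality Eᴮ
  cardinality-∪ = begin
    cardinality Eᴾ                       ≡⟨ cardinality-⇔ decomposition Eᴾ (union disjoint Fᴬ Fᴮ) ⟩
    cardinality (union disjoint Fᴬ Fᴮ)   ≡⟨ cardinality-union disjoint Fᴬ Fᴮ ⟩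
    cardinality Fᴬ + cardinality Fᴮ      ≡⟨ cong₂ _+_ (cardinality-image f-inj Eᴬ) (cardinality-image k-inj Eᴮ) ⟩
    cardinality Eᴬ + cardinality Eᴮ      ∎
    where open ≡-Reasoning

  totalParts-∪ : ∀ m n → (∀ xs → length (f xs) ≡ m + length xs) → (∀ xs → length (k xs) ≡ n + length xs) →
                 totalParts Eᴾ ≡ (totalParts Eᴬ + m * cardinality Eᴬ) + (totalParts Eᴮ + n * cardinality Eᴮ)
  totalParts-∪ m n length-f length-k = begin
    totalParts Eᴾ                       ≡⟨ totalParts-⇔ decomposition Eᴾ (union disjoint Fᴬ Fᴮ) ⟩
    totalParts (union disjoint Fᴬ Fᴮ)   ≡⟨ totalParts-union disjoint Fᴬ Fᴮ ⟩
    totalParts Fᴬ + totalParts Fᴮ       ≡⟨ cong₂ _+_ (totalParts-image f-inj Eᴬ m length-f)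
                                                     (totalParts-image k-inj Eᴮ n length-k) ⟩
    (totalParts Eᴬ + m * cardinality Eᴬ) + (totalParts Eᴮ + n * cardinality Eᴮ) ∎
    where open ≡-Reasoning

module _ {P A B C f k l}
  (decomposition : ∀ xs → P xs ⇔ (Image f A ∪ (Image k B ∪ Image l C)) xs)
  (disjoint : ∀ {xs} → Image f A xs → (Image k B ∪ Image l C) xs → ⊥)
  (disjoint′ : ∀ {xs} → Image k B xs → Image l C xs → ⊥)
  (f-inj : InjectiveOn A f) (k-inj : InjectiveOn B k) (l-inj : InjectiveOn C l)
  (Eᴾ : Enumeration P) (Eᴬ : Enumeration A) (Eᴮ : Enumeration B) (Eᶜ : Enumeration C)
  where

  private
    Fᴬ = image f-inj Eᴬ
    Fᴮ = image k-inj Eᴮ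
    Fᶜ = image l-inj Eᶜ

  cardinality-∪∪ : cardinality Eᴾ ≡ cardinality Eᴬ + (cardinality Eᴮ + cardinality Eᶜ)
  cardinality-∪∪ = begin
    cardinality Eᴾ
      ≡⟨ cardinality-⇔ decomposition Eᴾ (union disjoint Fᴬ (union disjoint′ Fᴮ Fᶜ)) ⟩
    cardinality (union disjoint Fᴬ (union disjoint′ Fᴮ Fᶜ))
      ≡⟨ cardinality-union disjoint Fᴬ (union disjoint′ Fᴮ Fᶜ) ⟩
    cardinality Fᴬ + cardinality (union disjoint′ Fᴮ Fᶜ)
      ≡⟨ cong (cardinality Fᴬ +_) (cardinality-union disjoint′ Fᴮ Fᶜ) ⟩
    cardinality Fᴬ + (cardinality Fᴮ + cardinality Fᶜ)
      ≡⟨ cong₂ _+_ (cardinality-image f-inj Eᴬ)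
                   (cong₂ _+_ (cardinality-image k-inj Eᴮ) (cardinality-image l-inj Eᶜ)) ⟩
    cardinality Eᴬ + (cardinality Eᴮ + cardinality Eᶜ) ∎
    where open ≡-Reasoning

-- Growing a partition at its largest part

-- The values of dup and inc at [] are junk, chosen so that both maps are injective and
-- change the length uniformly.
inc dup : List ℕ → List ℕ
inc []       = []
inc (x ∷ xs) = suc x ∷ xs
dup []       = 0 ∷ []
dup (x ∷ xs) = x ∷ x ∷ xs

inc-injective : ∀ {xs ys} → inc xs ≡ inc ys → xs ≡ ys
inc-injective {[]}    {[]}    refl = refl
inc-injective {_ ∷ _} {_ ∷ _} refl = refl

dup-injective : ∀ {xs ys} → dup xs ≡ dup ys → xs ≡ ys
dup-injective {[]}    {[]}    refl = refl
dup-injective {_ ∷ _} {_ ∷ _} eq   = ∷-injectiveʳ eq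

length-inc : ∀ xs → length (inc xs) ≡ length xs
length-inc []      = refl
length-inc (_ ∷ _) = refl

length-dup : ∀ xs → length (dup xs) ≡ suc (length xs)
length-dup []      = refl
length-dup (_ ∷ _) = refl

perimeter : ∀ x xs → x + length (x ∷ xs) ∸ 1 ≡ x + length xs
perimeter x xs = cong (_∸ 1) (+-suc x (length xs))

≥-trans : ∀ {x y z} → x ≥ y → y ≥ z → x ≥ z
≥-trans x≥y y≥z = ≤-trans y≥z x≥y

tail-≤ : ∀ {M x xs} → PartitionOfPerimeter M (x ∷ xs) → All (_≤ x) xs
tail-≤ ((dec , _) , _) = All.tail (Linked⇒All ≥-trans ≤-refl dec)

cons-≥ : ∀ {x xs} → All (_≤ x) xs → Linked _≥_ xs → Linked _≥_ (x ∷ xs)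
cons-≥ []        _   = [-]
cons-≥ (y≤x ∷ _) dec = y≤x ∷ dec

module _ {x : ℕ} {xs : List ℕ} where

  inc-partition⁺ : ∀ {M} → PartitionOfPerimeter M (x ∷ xs) → PartitionOfPerimeter (suc M) (suc x ∷ xs)
  inc-partition⁺ p@((dec , _ ∷ pos) , per) =
    (cons-≥ (All.map m≤n⇒m≤1+n (tail-≤ p)) (Linked.tail dec) , z<s ∷ pos) ,
    trans (+-suc x (length xs)) (cong suc (trans (sym (perimeter x xs)) per))

  -- The two extra hypotheses are what lowering the head could destroy: positivity and weak
  -- decrease.
  inc-partition⁻ : ∀ {M} → 0 < x → All (_≤ x) xs →
                   PartitionOfPerimeter (suc M) (suc x ∷ xs) → PartitionOfPerimeter M (x ∷ xs)
  inc-partition⁻ 0<x xs≤x ((dec , _ ∷ pos) , per) =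
    (cons-≥ xs≤x (Linked.tail dec) , 0<x ∷ pos) ,
    trans (perimeter x xs) (suc-injective (trans (sym (+-suc x (length xs))) per))

  dup-partition⁺ : ∀ {M} → PartitionOfPerimeter M (x ∷ xs) → PartitionOfPerimeter (suc M) (x ∷ x ∷ xs)
  dup-partition⁺ ((dec , 0<x ∷ pos) , per) =
    (≤-refl ∷ dec , 0<x ∷ 0<x ∷ pos) ,
    trans (perimeter x (x ∷ xs))
          (trans (+-suc x (length xs)) (cong suc (trans (sym (perimeter x xs)) per)))

  dup-partition⁻ : ∀ {M} → PartitionOfPerimeter (suc M) (x ∷ x ∷ xs) → PartitionOfPerimeter M (x ∷ xs)
  dup-partition⁻ ((dec , _ ∷ pos) , per) =
    (Linked.tail dec , pos) ,
    trans (perimeter x xs)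
          (suc-injective (trans (sym (+-suc x (length xs))) (trans (sym (perimeter x (x ∷ xs))) per)))

-- The list is `inc (dup (x ∷ xs))`; the second part supplies the positivity and the bound needed to
-- undo `inc`.
step-partition⁻ : ∀ {M x xs} → PartitionOfPerimeter (suc (suc M)) (suc x ∷ x ∷ xs) →
                  PartitionOfPerimeter M (x ∷ xs)
step-partition⁻ p@((_ ∷ dec , _ ∷ 0<x ∷ _) , _) =
  dup-partition⁻ (inc-partition⁻ 0<x (Linked⇒All ≥-trans ≤-refl dec) p)

-- The cases record the excess of the largest part over the next one: 0, 1, or at least 2. They show
-- which of `dup`, `inc ∘ dup` and `inc ∘ inc` can be undone; the bound in `gap` permits lowering
-- the head twice.
data Shape : List ℕ → Set where
  level : ∀ x xs → Shape (x ∷ x ∷ xs)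
  step  : ∀ x xs → Shape (suc x ∷ x ∷ xs)
  gap   : ∀ x {xs} → All (_≤ x) xs → Shape (suc (suc x) ∷ xs)

shape : ∀ {M xs} → PartitionOfPerimeter (suc (suc M)) xs → Shape xs
-- A single part equals the perimeter, hence is at least 2 and counts as a gap.
shape {xs = zero ∷ []}        (_ , ())
shape {xs = suc zero ∷ []}    (_ , ())
shape {xs = suc (suc x) ∷ []} _ = gap x []
shape {xs = _ ∷ _ ∷ _} ((y≤x ∷ dec , _) , _) = compare y≤x dec
  where
  compare : ∀ {x y xs} → y ≤ x → Linked _≥_ (y ∷ xs) → Shape (x ∷ y ∷ xs)
  compare y≤x dec with m≤n⇒m<n∨m≡n y≤x
  ... | inj₂ refl = level _ _
  ... | inj₁ (s≤s y≤x′) with m≤n⇒m<n∨m≡n y≤x′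
  ...   | inj₂ refl       = step _ _
  ...   | inj₁ (s≤s y≤x″) = gap _ (Linked⇒All ≥-trans y≤x″ dec)

suc∉ : ∀ {x xs} → All (_≤ x) xs → All (suc x ≢_) xs
suc∉ = All.map λ { y≤x refl → <-irrefl refl y≤x }

suc∉tail : ∀ {M x xs} → PartitionOfPerimeter M (x ∷ xs) → All (suc x ≢_) xs
suc∉tail = suc∉ ∘ tail-≤

-- Partitions into odd parts

even-suc-suc⁺ : ∀ {n} → Even n → Even (suc (suc n))
even-suc-suc⁺ = ∣m∣n⇒∣m+n ∣-refl

even-suc-suc⁻ : ∀ {n} → Even (suc (suc n)) → Even n
even-suc-suc⁻ e = ∣m+n∣m⇒∣n e ∣-refl

-- Otherwise 2 would divide the difference 1 of consecutive numbers.
even⇒odd-suc : ∀ {n} → Even n → Odd (suc n)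
even⇒odd-suc {n} e e′ with ∣1⇒≡1 (∣m+n∣m⇒∣n (subst Even (+-comm 1 n) e′) e)
... | ()

odd⇒even-suc : ∀ {n} → Odd n → Even (suc n)
odd⇒even-suc {zero}        o = contradiction (2 ∣0) o
odd⇒even-suc {suc zero}    o = ∣-refl
odd⇒even-suc {suc (suc n)} o = even-suc-suc⁺ (odd⇒even-suc (o ∘ even-suc-suc⁺))

odd-suc⇒even : ∀ {n} → Odd (suc n) → Even n
odd-suc⇒even = even-suc-suc⁻ ∘ odd⇒even-suc

odd⇒positive : ∀ {n} → Odd n → 0 < n
odd⇒positive {zero}  o = contradiction (2 ∣0) o
odd⇒positive {suc n} _ = z<s

-- A step would put two consecutive numbers among the odd parts. A level undoes `dup`, and a gap is
-- lowered by two so that the head stays odd.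
𝒢-decomposition : ∀ M xs → 𝒢 (suc (suc M)) xs ⇔ (Image dup (𝒢 (suc M)) ∪ Image (inc ∘ inc) (𝒢 M)) xs
𝒢-decomposition M xs = mk⇔ forward backward
  where
  forward : ∀ {xs} → 𝒢 (suc (suc M)) xs → (Image dup (𝒢 (suc M)) ∪ Image (inc ∘ inc) (𝒢 M)) xs
  forward (p , odd) with shape p | odd
  ... | level x xs | _ ∷ odd    = inj₁ (x ∷ xs , (dup-partition⁻ p , odd) , refl)
  ... | step x xs  | o ∷ o′ ∷ _ = contradiction (odd-suc⇒even o) o′
  ... | gap x {xs} xs≤x | o ∷ odd =
    inj₂ (x ∷ xs , (inc-partition⁻ (odd⇒positive o′) xs≤x
                     (inc-partition⁻ z<s (All.map m≤n⇒m≤1+n xs≤x) p) , o′ ∷ odd) , refl)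
    where o′ = o ∘ even-suc-suc⁺

  backward : ∀ {xs} → (Image dup (𝒢 (suc M)) ∪ Image (inc ∘ inc) (𝒢 M)) xs → 𝒢 (suc (suc M)) xs
  backward (inj₁ (x ∷ xs , (p , o ∷ odd) , refl)) = dup-partition⁺ p , o ∷ o ∷ odd
  backward (inj₂ (x ∷ xs , (p , o ∷ odd) , refl)) =
    inc-partition⁺ (inc-partition⁺ p) , o ∘ even-suc-suc⁻ ∷ odd

-- After `inc ∘ inc` the head exceeds every other part, whereas `dup` repeats it.
𝒢-disjoint : ∀ {M xs} → Image dup (𝒢 (suc M)) xs → Image (inc ∘ inc) (𝒢 M) xs → ⊥
𝒢-disjoint (x ∷ xs , _ , refl) (y ∷ _ , (p , _) , refl) with tail-≤ p
... | x≤y ∷ _ = <-irrefl refl (≤-trans (n≤1+n _) x≤y)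

∣𝒢∣ : ∀ M → cardinality (𝒢-enum M) ≡ F M
∣𝒢∣ zero          = refl
∣𝒢∣ (suc zero)    = refl
∣𝒢∣ (suc (suc M)) = trans
  (cardinality-∪ (𝒢-decomposition M) 𝒢-disjoint (λ _ _ → dup-injective) (λ _ _ → inc-injective ∘ inc-injective)
                 (𝒢-enum (suc (suc M))) (𝒢-enum (suc M)) (𝒢-enum M))
  (cong₂ _+_ (∣𝒢∣ (suc M)) (∣𝒢∣ M))

g-recurrence : ∀ M → g (suc (suc M)) ≡ g (suc M) + g M + F (suc M)
g-recurrence M = begin
  g (suc (suc M))
    ≡⟨ totalParts-∪ (𝒢-decomposition M) 𝒢-disjoint (λ _ _ → dup-injective) (λ _ _ → inc-injective ∘ inc-injective)
                    (𝒢-enum (suc (suc M))) (𝒢-enum (suc M)) (𝒢-enum M)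
                    -- The numbers of parts gained: one under `dup`, none under `inc ∘ inc`. The
                    -- Fibonacci term thus counts the image of `𝒢 (suc M)`.
                    1 0 length-dup (λ xs → trans (length-inc (inc xs)) (length-inc xs)) ⟩
  (g (suc M) + 1 * cardinality (𝒢-enum (suc M))) + (g M + 0)
    ≡⟨ cong (λ c → (g (suc M) + 1 * c) + (g M + 0)) (∣𝒢∣ (suc M)) ⟩
  (g (suc M) + 1 * F (suc M)) + (g M + 0)
    ≡⟨ regroup (g (suc M)) (g M) (F (suc M)) ⟩
  g (suc M) + g M + F (suc M) ∎
  where
  open ≡-Reasoning
  regroup : ∀ a b c → (a + 1 * c) + (b + 0) ≡ a + b + c
  regroup = solve-∀

-- Partitions into distinct parts

-- A level contradicts distinctness. In a gap the head can drop by one and still exceed the rest; in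
-- a step it would collide with the next part, so that part's extra copy is removed as well.
ℋ-decomposition : ∀ M xs → ℋ (suc (suc M)) xs ⇔ (Image inc (ℋ (suc M)) ∪ Image (inc ∘ dup) (ℋ M)) xs
ℋ-decomposition M xs = mk⇔ forward backward
  where
  forward : ∀ {xs} → ℋ (suc (suc M)) xs → (Image inc (ℋ (suc M)) ∪ Image (inc ∘ dup) (ℋ M)) xs
  forward (p , distinct) with shape p | distinct
  ... | level x xs      | (x≢x ∷ _) ∷ _ = contradiction refl x≢x
  ... | step x xs       | _ ∷ xs!       = inj₂ (x ∷ xs , (step-partition⁻ p , xs!) , refl)
  ... | gap x {xs} xs≤x | _ ∷ xs!       =
    inj₁ (suc x ∷ xs , (inc-partition⁻ z<s (All.map m≤n⇒m≤1+n xs≤x) p , suc∉ xs≤x ∷ xs!) , refl)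

  backward : ∀ {xs} → (Image inc (ℋ (suc M)) ∪ Image (inc ∘ dup) (ℋ M)) xs → ℋ (suc (suc M)) xs
  backward (inj₁ (x ∷ xs , (p , _ ∷ xs!) , refl)) = inc-partition⁺ p , suc∉tail p ∷ xs!
  backward (inj₂ (x ∷ xs , (p , xs!) , refl)) =
    inc-partition⁺ (dup-partition⁺ p) , suc∉tail (dup-partition⁺ p) ∷ xs!

-- A common value would force the preimage under `inc` to repeat its largest part.
ℋ-disjoint : ∀ {M xs} → Image inc (ℋ (suc M)) xs → Image (inc ∘ dup) (ℋ M) xs → ⊥
ℋ-disjoint (x ∷ _ , (_ , (x≢x ∷ _) ∷ _) , refl) (_ ∷ _ , _ , refl) = x≢x refl

∣ℋ∣ : ∀ M → cardinality (ℋ-enum M) ≡ F M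
∣ℋ∣ zero          = refl
∣ℋ∣ (suc zero)    = refl
∣ℋ∣ (suc (suc M)) = trans
  (cardinality-∪ (ℋ-decomposition M) ℋ-disjoint (λ _ _ → inc-injective) (λ _ _ → dup-injective ∘ inc-injective)
                 (ℋ-enum (suc (suc M))) (ℋ-enum (suc M)) (ℋ-enum M))
  (cong₂ _+_ (∣ℋ∣ (suc M)) (∣ℋ∣ M))

h-recurrence : ∀ M → h (suc (suc M)) ≡ h (suc M) + h M + F M
h-recurrence M = begin
  h (suc (suc M))
    ≡⟨ totalParts-∪ (ℋ-decomposition M) ℋ-disjoint (λ _ _ → inc-injective) (λ _ _ → dup-injective ∘ inc-injective)
                    (ℋ-enum (suc (suc M))) (ℋ-enum (suc M)) (ℋ-enum M)
                    -- Here the added part comes with the image of `ℋ M`, which is why the Fibonacci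
                    -- index is one lower than for `g`.
                    0 1 length-inc (λ xs → trans (length-inc (dup xs)) (length-dup xs)) ⟩
  (h (suc M) + 0) + (h M + 1 * cardinality (ℋ-enum M))
    ≡⟨ cong (λ c → (h (suc M) + 0) + (h M + 1 * c)) (∣ℋ∣ M) ⟩
  (h (suc M) + 0) + (h M + 1 * F M)
    ≡⟨ regroup (h (suc M)) (h M) (F M) ⟩
  h (suc M) + h M + F M ∎
  where
  open ≡-Reasoning
  regroup : ∀ a b c → (a + 0) + (b + 1 * c) ≡ a + b + c
  regroup = solve-∀

-- Partitions with one even part

module _ {x : ℕ} {xs : List ℕ} where

  oneEven-odd∷⁺ : Odd x → OneEvenPart xs → OneEvenPart (x ∷ xs)
  oneEven-odd∷⁺ o (e , e∈xs , even , odd) = e , there e∈xs , even , const o ∷ odd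

  oneEven-odd∷⁻ : Odd x → OneEvenPart (x ∷ xs) → OneEvenPart xs
  oneEven-odd∷⁻ o (e , here refl  , even , _)       = contradiction even o
  oneEven-odd∷⁻ o (e , there e∈xs , even , _ ∷ odd) = e , e∈xs , even , odd

  oneEven-even∷⁺ : Even x → OddParts xs → OneEvenPart (x ∷ xs)
  oneEven-even∷⁺ e odd = x , here refl , e , (λ x≢x → contradiction refl x≢x) ∷ All.map const odd

  -- An even head must be the exceptional value, and since it does not recur, every part of the tail
  -- falls under the oddness clause.
  oneEven-even∷⁻ : Even x → All (x ≢_) xs → OneEvenPart (x ∷ xs) → OddParts xs
  oneEven-even∷⁻ even x∉xs (e , _ , _ , o ∷ odd) with x ≟ e
  ... | yes refl = All.zipWith (λ (x≢y , o) → o (≢-sym x≢y)) (x∉xs , odd)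
  ... | no x≢e   = contradiction even (o x≢e)

  oneEven-dup⁺ : OneEvenPart (x ∷ xs) → OneEvenPart (x ∷ x ∷ xs)
  oneEven-dup⁺ (e , e∈ , even , o ∷ odd) = e , there e∈ , even , o ∷ o ∷ odd

  oneEven-dup⁻ : OneEvenPart (x ∷ x ∷ xs) → OneEvenPart (x ∷ xs)
  oneEven-dup⁻ (e , here refl , even , _ ∷ odd) = e , here refl , even , odd
  oneEven-dup⁻ (e , there e∈  , even , _ ∷ odd) = e , e∈ , even , odd

-- Both branches produce an odd largest part and leave an even value in the tail: an even head
-- survives as the second part, while below an odd head the even value already lies in the tail.
φ : List ℕ → List ℕ
φ []       = []
φ (x ∷ xs) = if does (2 ∣? x) then inc (dup (x ∷ xs)) else inc (inc (x ∷ xs))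

φ-even : ∀ {x xs} → Even x → φ (x ∷ xs) ≡ suc x ∷ x ∷ xs
φ-even {x} e rewrite dec-true (2 ∣? x) e = refl

φ-odd : ∀ {x xs} → Odd x → φ (x ∷ xs) ≡ suc (suc x) ∷ xs
φ-odd {x} o rewrite dec-false (2 ∣? x) o = refl

-- The result list is an index, so that matching on the view together with `φ (x ∷ xs)` replaces the
-- conditional by its explicit value.
data φ-View (x : ℕ) (xs : List ℕ) : List ℕ → Set where
  headEven : Even x → φ-View x xs (suc x ∷ x ∷ xs)
  headOdd  : Odd x → φ-View x xs (suc (suc x) ∷ xs)

φ-view : ∀ x xs → φ-View x xs (φ (x ∷ xs))
φ-view x xs with 2 ∣? x
... | yes e = subst (φ-View x xs) (sym (φ-even e)) (headEven e)
... | no  o = subst (φ-View x xs) (sym (φ-odd o)) (headOdd o)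

step≢gap : ∀ {M x xs y ys} → PartitionOfPerimeter M (y ∷ ys) → suc x ∷ x ∷ xs ≢ suc (suc y) ∷ ys
step≢gap p refl with tail-≤ p
... | x≤y ∷ _ = <-irrefl refl x≤y

-- The branch can be read off the result: the head exceeds the next part by exactly one after an
-- even head, and by at least two, if there is a next part, after an odd one.
φ-injective : ∀ {M} → InjectiveOn (𝒢₁ M) φ
φ-injective {xs = x ∷ xs} {y ∷ ys} (p , _) (q , _) eq
  with φ (x ∷ xs) | φ-view x xs | φ (y ∷ ys) | φ-view y ys
... | _ | headEven _ | _ | headEven _ = ∷-injectiveʳ eq
... | _ | headEven _ | _ | headOdd _  = contradiction eq (step≢gap q)
... | _ | headOdd _  | _ | headEven _ = contradiction (sym eq) (step≢gap p)
... | _ | headOdd _  | _ | headOdd _  = inc-injective (inc-injective eq)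

-- Outside the level case the largest part occurs once. If it is even, all other parts are odd and
-- lowering it by one lands in `𝒢`. If it is odd, the even value lies in the tail and `φ` can be
-- undone.
𝒢₁-decomposition : ∀ M xs → 𝒢₁ (suc (suc M)) xs ⇔
                   (Image inc (𝒢 (suc M)) ∪ (Image dup (𝒢₁ (suc M)) ∪ Image φ (𝒢₁ M))) xs
𝒢₁-decomposition M xs = mk⇔ forward backward
  where
  forward : ∀ {xs} → 𝒢₁ (suc (suc M)) xs →
            (Image inc (𝒢 (suc M)) ∪ (Image dup (𝒢₁ (suc M)) ∪ Image φ (𝒢₁ M))) xs
  forward (p , one) with shape p
  ... | level x xs = inj₂ (inj₁ (x ∷ xs , (dup-partition⁻ p , oneEven-dup⁻ one) , refl))
  ... | step x xs with 2 ∣? suc x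
  -- The preimage under `inc` repeats `x`; the oddness of the tail `x ∷ xs` therefore covers both
  -- copies.
  ...   | yes e = inj₁ (x ∷ x ∷ xs , (dup-partition⁺ q , All.head odd ∷ odd) , refl)
    where
    q   = step-partition⁻ p
    odd = oneEven-even∷⁻ e (suc∉tail (dup-partition⁺ q)) one
  ...   | no o  = inj₂ (inj₂ (x ∷ xs , (step-partition⁻ p , oneEven-odd∷⁻ o one) , φ-even (odd-suc⇒even o)))
  forward (p , one) | gap x {xs} xs≤x with 2 ∣? x
  ...   | yes e = inj₁ (suc x ∷ xs , (q , even⇒odd-suc e ∷ oneEven-even∷⁻ (even-suc-suc⁺ e) (suc∉tail q) one) , refl)
    where q = inc-partition⁻ z<s (All.map m≤n⇒m≤1+n xs≤x) p
  ...   | no o  = inj₂ (inj₂ (x ∷ xs ,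
    (inc-partition⁻ (odd⇒positive o) xs≤x (inc-partition⁻ z<s (All.map m≤n⇒m≤1+n xs≤x) p) ,
     oneEven-odd∷⁺ o (oneEven-odd∷⁻ (o ∘ even-suc-suc⁻) one)) , φ-odd o))

  backward : ∀ {xs} → (Image inc (𝒢 (suc M)) ∪ (Image dup (𝒢₁ (suc M)) ∪ Image φ (𝒢₁ M))) xs →
             𝒢₁ (suc (suc M)) xs
  backward (inj₁ (x ∷ xs , (p , o ∷ odd) , refl))      = inc-partition⁺ p , oneEven-even∷⁺ (odd⇒even-suc o) odd
  backward (inj₂ (inj₁ (x ∷ xs , (p , one) , refl))) = dup-partition⁺ p , oneEven-dup⁺ one
  backward (inj₂ (inj₂ (x ∷ xs , (p , one) , refl))) with φ (x ∷ xs) | φ-view x xs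
  ... | _ | headEven e = inc-partition⁺ (dup-partition⁺ p) , oneEven-odd∷⁺ (even⇒odd-suc e) one
  ... | _ | headOdd o  = inc-partition⁺ (inc-partition⁺ p) ,
                     oneEven-odd∷⁺ (o ∘ even-suc-suc⁻) (oneEven-odd∷⁻ o one)

-- The image of `𝒢` has an even largest part occurring once; `dup` repeats the largest part and `φ`
-- makes it odd.
𝒢₁-disjoint : ∀ {M xs} → Image inc (𝒢 (suc M)) xs → (Image dup (𝒢₁ (suc M)) ∪ Image φ (𝒢₁ M)) xs → ⊥
𝒢₁-disjoint (x ∷ _ , (p , _) , refl) (inj₁ (y ∷ ys , _ , refl)) = All.head (suc∉tail p) refl
𝒢₁-disjoint (x ∷ xs , (p , o ∷ _) , eq) (inj₂ (y ∷ ys , _ , eq′))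
  with φ (y ∷ ys) | φ-view y ys
... | _ | headEven e rewrite sym eq with refl ← eq′ = o e
... | _ | headOdd o′ rewrite sym eq with refl ← eq′ = o (odd⇒even-suc o′)

𝒢₁-disjoint′ : ∀ {M xs} → Image dup (𝒢₁ (suc M)) xs → Image φ (𝒢₁ M) xs → ⊥
𝒢₁-disjoint′ (x ∷ xs , _ , eq) (y ∷ ys , (p , _) , eq′)
  with φ (y ∷ ys) | φ-view y ys
𝒢₁-disjoint′ (x ∷ xs , _ , refl) (y ∷ ys , (p , _) , ())   | _ | headEven _
𝒢₁-disjoint′ (x ∷ xs , _ , refl) (y ∷ ys , (p , _) , refl) | _ | headOdd _ =
  <-irrefl refl (≤-trans (n≤1+n _) (All.head (tail-≤ p)))

g₁-recurrence : ∀ M → g₁ (suc (suc M)) ≡ g₁ (suc M) + g₁ M + F (suc M)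
g₁-recurrence M = begin
  g₁ (suc (suc M))
    ≡⟨ cardinality-∪∪ (𝒢₁-decomposition M) 𝒢₁-disjoint 𝒢₁-disjoint′
         (λ _ _ → inc-injective) (λ _ _ → dup-injective) φ-injective
         (𝒢₁-enum (suc (suc M))) (𝒢-enum (suc M)) (𝒢₁-enum (suc M)) (𝒢₁-enum M) ⟩
  cardinality (𝒢-enum (suc M)) + (g₁ (suc M) + g₁ M)
    ≡⟨ +-comm (cardinality (𝒢-enum (suc M))) _ ⟩
  g₁ (suc M) + g₁ M + cardinality (𝒢-enum (suc M))
    ≡⟨ cong (g₁ (suc M) + g₁ M +_) (∣𝒢∣ (suc M)) ⟩
  g₁ (suc M) + g₁ M + F (suc M) ∎
  where open ≡-Reasoning

-- Partitions with one repeated part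

multiplicity-≡ : ∀ {v} xs → multiplicity v (v ∷ xs) ≡ suc (multiplicity v xs)
multiplicity-≡ {v} xs = cong length (filter-accept (v ≟_) refl)

multiplicity-≢ : ∀ {v x} xs → v ≢ x → multiplicity v (x ∷ xs) ≡ multiplicity v xs
multiplicity-≢ {v} xs v≢x = cong length (filter-reject (v ≟_) v≢x)

multiplicity-∉ : ∀ {v xs} → All (v ≢_) xs → multiplicity v xs ≡ 0
multiplicity-∉ {v} v∉xs = cong length (filter-none (v ≟_) v∉xs)

multiplicity-∈ : ∀ {v xs} → v ∈ xs → 0 < multiplicity v xs
multiplicity-∈ {v} = filter-some (v ≟_)

∉∧∈⇒≢ : ∀ {x u : ℕ} {xs} → All (x ≢_) xs → u ∈ xs → u ≢ x
∉∧∈⇒≢ x∉xs u∈xs u≡x = All.lookup x∉xs u∈xs (sym u≡x)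

unique⇒multiplicity : ∀ {u xs} → Unique xs → u ∈ xs → multiplicity u xs ≡ 1
unique⇒multiplicity {xs = _ ∷ xs} (x∉xs ∷ _)   (here refl)  =
  trans (multiplicity-≡ xs) (cong suc (multiplicity-∉ x∉xs))
unique⇒multiplicity {xs = _ ∷ xs} (x∉xs ∷ xs!) (there u∈xs) =
  trans (multiplicity-≢ xs (∉∧∈⇒≢ x∉xs u∈xs)) (unique⇒multiplicity xs! u∈xs)

-- If the head recurred in the tail, its multiplicity would be at least two.
multiplicity⇒unique : ∀ xs → (∀ {u} → u ∈ xs → multiplicity u xs ≡ 1) → Unique xs
multiplicity⇒unique []       mult≡1 = []
multiplicity⇒unique (x ∷ xs) mult≡1 = x∉xs ∷ multiplicity⇒unique xs λ u∈xs →
  trans (sym (multiplicity-≢ xs (∉∧∈⇒≢ x∉xs u∈xs))) (mult≡1 (there u∈xs))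
  where
  x∉xs : All (x ≢_) xs
  x∉xs = ¬Any⇒All¬ xs λ x∈xs →
    <⇒≢ (multiplicity-∈ x∈xs) (sym (suc-injective (trans (sym (multiplicity-≡ xs)) (mult≡1 (here refl)))))

-- This is the last clause of `OneRepeatedPart`. It allows `x` any multiplicity, even zero, so it
-- survives adding or removing a leading copy of `x`.
SimpleExcept : ℕ → List ℕ → Set
SimpleExcept x xs = All (λ u → u ≢ x → multiplicity u xs ≡ 1) xs

module _ {x : ℕ} {xs : List ℕ} where

  simpleExcept-∷⁺ : SimpleExcept x xs → SimpleExcept x (x ∷ xs)
  simpleExcept-∷⁺ s = (λ x≢x → contradiction refl x≢x) ∷
                      All.map (λ m≡1 u≢x → trans (multiplicity-≢ xs u≢x) (m≡1 u≢x)) s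

  simpleExcept-∷⁻ : SimpleExcept x (x ∷ xs) → SimpleExcept x xs
  simpleExcept-∷⁻ (_ ∷ s) = All.map (λ m≡1 u≢x → trans (sym (multiplicity-≢ xs u≢x)) (m≡1 u≢x)) s

  unique⇒simpleExcept : Unique xs → SimpleExcept x xs
  unique⇒simpleExcept xs! = All.tabulate λ u∈xs _ → unique⇒multiplicity xs! u∈xs

  simpleExcept⇒unique : All (x ≢_) xs → SimpleExcept x xs → Unique xs
  simpleExcept⇒unique x∉xs s = multiplicity⇒unique xs λ u∈xs → All.lookup s u∈xs (∉∧∈⇒≢ x∉xs u∈xs)

  oneRepeated-∈⁺ : x ∈ xs → SimpleExcept x xs → OneRepeatedPart (x ∷ xs)
  oneRepeated-∈⁺ x∈xs s =
    x , here refl , subst (2 ≤_) (sym (multiplicity-≡ xs)) (s≤s (multiplicity-∈ x∈xs)) , simpleExcept-∷⁺ s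

  -- A head that recurs must be the repeated value, since any other value has multiplicity one.
  oneRepeated-∈⁻ : x ∈ xs → OneRepeatedPart (x ∷ xs) → SimpleExcept x xs
  oneRepeated-∈⁻ x∈xs (v , _ , _ , s@(m≡1 ∷ _)) with x ≟ v
  ... | yes refl = simpleExcept-∷⁻ s
  ... | no x≢v   = contradiction (sym (suc-injective (trans (sym (multiplicity-≡ xs)) (m≡1 x≢v))))
                                 (<⇒≢ (multiplicity-∈ x∈xs))

  oneRepeated-∉⁺ : All (x ≢_) xs → OneRepeatedPart xs → OneRepeatedPart (x ∷ xs)
  oneRepeated-∉⁺ x∉xs (v , v∈xs , 2≤m , s) =
    v , there v∈xs , subst (2 ≤_) (sym (multiplicity-≢ xs (∉∧∈⇒≢ x∉xs v∈xs))) 2≤m ,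
    (λ _ → trans (multiplicity-≡ xs) (cong suc (multiplicity-∉ x∉xs))) ∷
    All.tabulate λ u∈xs u≢v → trans (multiplicity-≢ xs (∉∧∈⇒≢ x∉xs u∈xs)) (All.lookup s u∈xs u≢v)

  -- A fresh head has multiplicity one, so the repeated value lies in the tail and no multiplicity
  -- there changes.
  oneRepeated-∉⁻ : All (x ≢_) xs → OneRepeatedPart (x ∷ xs) → OneRepeatedPart xs
  oneRepeated-∉⁻ x∉xs (v , here refl , 2≤m , _) =
    contradiction (subst (2 ≤_) (trans (multiplicity-≡ xs) (cong suc (multiplicity-∉ x∉xs))) 2≤m) λ { (s≤s ()) }
  oneRepeated-∉⁻ x∉xs (v , there v∈xs , 2≤m , _ ∷ s) =
    v , v∈xs , subst (2 ≤_) (multiplicity-≢ xs (∉∧∈⇒≢ x∉xs v∈xs)) 2≤m ,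
    All.tabulate λ u∈xs u≢v → trans (sym (multiplicity-≢ xs (∉∧∈⇒≢ x∉xs u∈xs))) (All.lookup s u∈xs u≢v)

-- Each branch keeps the status of the largest part: a repeated one gets a further copy, an
-- unrepeated one is raised and stays unrepeated. Hence the repeated value remains the only one.
ψ : List ℕ → List ℕ
ψ []       = []
ψ (x ∷ xs) = if does (x ∈? xs) then dup (x ∷ xs) else inc (x ∷ xs)

ψ-∈ : ∀ {x xs} → x ∈ xs → ψ (x ∷ xs) ≡ x ∷ x ∷ xs
ψ-∈ {x} {xs} x∈xs rewrite dec-true (x ∈? xs) x∈xs = refl

ψ-∉ : ∀ {x xs} → x ∉ xs → ψ (x ∷ xs) ≡ suc x ∷ xs
ψ-∉ {x} {xs} x∉xs rewrite dec-false (x ∈? xs) x∉xs = refl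

data ψ-View (x : ℕ) (xs : List ℕ) : List ℕ → Set where
  repeated : x ∈ xs → ψ-View x xs (x ∷ x ∷ xs)
  simple   : x ∉ xs → ψ-View x xs (suc x ∷ xs)

ψ-view : ∀ x xs → ψ-View x xs (ψ (x ∷ xs))
ψ-view x xs with x ∈? xs
... | yes x∈xs = repeated x∈xs
... | no  x∉xs = simple x∉xs

dup≢inc : ∀ {M x xs y ys} → PartitionOfPerimeter M (y ∷ ys) → x ∷ x ∷ xs ≢ suc y ∷ ys
dup≢inc p refl = All.head (suc∉tail p) refl

-- The branch is visible in the result: the first two parts agree exactly when `dup` was applied.
ψ-injective : ∀ {M} → InjectiveOn (ℋ₁ M) ψ
ψ-injective {xs = x ∷ xs} {y ∷ ys} (p , _) (q , _) eq
  with ψ (x ∷ xs) | ψ-view x xs | ψ (y ∷ ys) | ψ-view y ys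
... | _ | repeated _ | _ | repeated _ = ∷-injectiveʳ eq
... | _ | repeated _ | _ | simple _   = contradiction eq (dup≢inc q)
... | _ | simple _   | _ | repeated _ = contradiction (sym eq) (dup≢inc p)
... | _ | simple _   | _ | simple _   = inc-injective eq

ℋ₁-decomposition : ∀ M xs → ℋ₁ (suc (suc M)) xs ⇔
                   (Image dup (ℋ (suc M)) ∪ (Image ψ (ℋ₁ (suc M)) ∪ Image (inc ∘ dup) (ℋ₁ M))) xs
ℋ₁-decomposition M xs = mk⇔ forward backward
  where
  forward : ∀ {xs} → ℋ₁ (suc (suc M)) xs →
            (Image dup (ℋ (suc M)) ∪ (Image ψ (ℋ₁ (suc M)) ∪ Image (inc ∘ dup) (ℋ₁ M))) xs
  forward (p , one) with shape p
  ... | step x xs = inj₂ (inj₂ (x ∷ xs , (q , oneRepeated-∉⁻ (suc∉tail (dup-partition⁺ q)) one) , refl))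
    where q = step-partition⁻ p
  ... | gap x {xs} xs≤x = inj₂ (inj₁ (suc x ∷ xs ,
    (q , oneRepeated-∉⁺ (suc∉ xs≤x) (oneRepeated-∉⁻ (suc∉tail q) one)) , ψ-∉ (All¬⇒¬Any (suc∉ xs≤x))))
    where q = inc-partition⁻ z<s (All.map m≤n⇒m≤1+n xs≤x) p
  -- The test separates at least three copies of the largest part, where one can be removed within
  -- `ℋ₁`, from exactly two, where removal leaves distinct parts.
  ... | level x xs with x ∈? xs
  ...   | yes x∈xs = inj₂ (inj₁ (x ∷ xs , (dup-partition⁻ p , oneRepeated-∈⁺ x∈xs s) , ψ-∈ x∈xs))
    where s = simpleExcept-∷⁻ (oneRepeated-∈⁻ (here refl) one)
  ...   | no x∉xs  = inj₁ (x ∷ xs ,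
    (dup-partition⁻ p , ¬Any⇒All¬ xs x∉xs ∷ simpleExcept⇒unique (¬Any⇒All¬ xs x∉xs) s) , refl)
    where s = simpleExcept-∷⁻ (oneRepeated-∈⁻ (here refl) one)

  backward : ∀ {xs} → (Image dup (ℋ (suc M)) ∪ (Image ψ (ℋ₁ (suc M)) ∪ Image (inc ∘ dup) (ℋ₁ M))) xs →
             ℋ₁ (suc (suc M)) xs
  backward (inj₁ (x ∷ xs , (p , _ ∷ xs!) , refl)) =
    dup-partition⁺ p , oneRepeated-∈⁺ (here refl) (simpleExcept-∷⁺ (unique⇒simpleExcept xs!))
  backward (inj₂ (inj₂ (x ∷ xs , (p , one) , refl))) =
    inc-partition⁺ (dup-partition⁺ p) , oneRepeated-∉⁺ (suc∉tail (dup-partition⁺ p)) one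
  backward (inj₂ (inj₁ (x ∷ xs , (p , one) , refl))) with ψ (x ∷ xs) | ψ-view x xs
  ... | _ | repeated x∈xs = dup-partition⁺ p , oneRepeated-∈⁺ (here refl) (simpleExcept-∷⁺ (oneRepeated-∈⁻ x∈xs one))
  ... | _ | simple x∉xs   = inc-partition⁺ p ,
                            oneRepeated-∉⁺ (suc∉tail p) (oneRepeated-∉⁻ (¬Any⇒All¬ xs x∉xs) one)

-- In the image of `ℋ` the largest part occurs exactly twice. Under `ψ` it occurs once or at least
-- three times, and after `inc ∘ dup` it differs from the next part.
ℋ₁-disjoint : ∀ {M xs} → Image dup (ℋ (suc M)) xs →
              (Image ψ (ℋ₁ (suc M)) ∪ Image (inc ∘ dup) (ℋ₁ M)) xs → ⊥
ℋ₁-disjoint (_ ∷ _ , _ , refl) (inj₂ (_ ∷ _ , _ , ()))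
ℋ₁-disjoint (x ∷ xs , (_ , x∉xs ∷ _) , eq) (inj₁ (y ∷ ys , (p , _) , eq′)) with ψ (y ∷ ys) | ψ-view y ys
... | _ | simple _      = dup≢inc p (trans eq (sym eq′))
... | _ | repeated y∈ys with refl ← trans eq (sym eq′) = All¬⇒¬Any x∉xs y∈ys

-- The image of `inc ∘ dup` begins with a step. The `dup` branch of `ψ` begins with a level, and a
-- step from its `inc` branch would need a repeated head before raising.
ℋ₁-disjoint′ : ∀ {M xs} → Image ψ (ℋ₁ (suc M)) xs → Image (inc ∘ dup) (ℋ₁ M) xs → ⊥
ℋ₁-disjoint′ (x ∷ xs , _ , eq) (y ∷ ys , _ , eq′) with ψ (x ∷ xs) | ψ-view x xs
... | _ | repeated _  with () ← trans eq (sym eq′)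
... | _ | simple x∉xs with refl ← trans eq (sym eq′) = x∉xs (here refl)

h₁-recurrence : ∀ M → h₁ (suc (suc M)) ≡ h₁ (suc M) + h₁ M + F (suc M)
h₁-recurrence M = begin
  h₁ (suc (suc M))
    ≡⟨ cardinality-∪∪ (ℋ₁-decomposition M) ℋ₁-disjoint ℋ₁-disjoint′
         (λ _ _ → dup-injective) ψ-injective (λ _ _ → dup-injective ∘ inc-injective)
         (ℋ₁-enum (suc (suc M))) (ℋ-enum (suc M)) (ℋ₁-enum (suc M)) (ℋ₁-enum M) ⟩
  cardinality (ℋ-enum (suc M)) + (h₁ (suc M) + h₁ M)
    ≡⟨ +-comm (cardinality (ℋ-enum (suc M))) _ ⟩
  h₁ (suc M) + h₁ M + cardinality (ℋ-enum (suc M))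
    ≡⟨ cong (h₁ (suc M) + h₁ M +_) (∣ℋ∣ (suc M)) ⟩
  h₁ (suc M) + h₁ M + F (suc M) ∎
  where open ≡-Reasoning

mainTheorem5 : (M : ℕ) → 2 ≤ M →
    (g M ≡ g (M ∸ 1) + g (M ∸ 2) + F (M ∸ 1))
    × (h M ≡ h (M ∸ 1) + h (M ∸ 2) + F (M ∸ 2))
    × (g₁ M ≡ g₁ (M ∸ 1) + g₁ (M ∸ 2) + F (M ∸ 1))
    × (h₁ M ≡ h₁ (M ∸ 1) + h₁ (M ∸ 2) + F (M ∸ 1))
mainTheorem5 (suc zero)    (s≤s ())
mainTheorem5 (suc (suc M)) _ = g-recurrence M , h-recurrence M , g₁-recurrence M , h₁-recurrence M
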